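{- Suppose $[0,1]_*=([0,1],\min,\max,*,\rightarrowtail,0,1)$ is a BL-algebra, and let $T_*$ be the topology on $[0,1]$ consisting of all $*$-open subsets of $[0,1]$. Then $T_*$ is a Hausdorff topology on $[0,1]$.
   Context: A BL-algebra is an algebra $\mathcal{L}=(L,\wedge,\vee,*,\rightarrowtail,0,1)$ of type $(2,2,2,2,0,0)$ such that: (BL1) $(L,\wedge,\vee,0,1)$ is a bounded lattice with greatest element $1$ and smallest element $0$; (BL2) $(L,*,1)$ is an Abelian monoid; (BL3) $c\le a\rightarrowtail b$ iff $c*a\le b$ for all $a,b,c\in L$; (BL4) $a\wedge b=a*(a\rightarrowtail b)$ for all $a,b\in L$; (BL5) $(a\rightarrowtail b)\vee(b\rightarrowtail a)=1$ for all $a,b\in L$. Here $L=[0,1]$ is the real unit interval with its usual order. An element $a\in L$ is strongly less than $1$, written $a\ll 1$, if for every $b\in L$, $a\vee b=1$ implies $b=1$ (on $[0,1]$ this just means $a<1$). Define $a\leftrightarrow b=(a\rightarrowtail b)*(b\rightarrowtail a)$ for $a,b\in L$. For $a,r\in L$ with $r\ll 1$, the $*$-ball around $a$ of radius $r$ is $B_r(a)=\{b\in L: a\leftrightarrow b>r\}$. A subset $G\subseteq L$ is $*$-open if for every $a\in G$ there exists $r\in L$ with $r\ll 1$ and $B_r(a)\subseteq G$. The $*$-open subsets of $L$ form a topology $T_*$. -}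

module Defs where

open import Algebra.Core using (Op₂)
open import Algebra.Definitions using (Congruent₂)
open import Algebra.Structures using (IsCommutativeMonoid)
open import Data.Product using (∃; _×_; _,_; proj₁; proj₂)
open import Data.Rational as ℚ using (ℚ; 0ℚ; 1ℚ)
import Data.Rational.Properties as ℚ
open import Data.Sum as Sum using (_⊎_; inj₁; inj₂)
open import Function using (_∘_; _⇔_; mk⇔; Equivalence)
open import Level using (Level; 0ℓ; _⊔_) renaming (suc to lsuc)
open import Relation.Binary.Core using (Rel)
open import Relation.Binary.Definitions using (_Respects_; tri<; tri≈; tri>)
import Relation.Binary.Construct.NonStrictToStrict as ToStrict
open import Relation.Binary.Lattice.Structures using (IsBoundedLattice)
open import Relation.Binary.PropositionalEquality using (refl; sym)
open import Relation.Nullary using (¬_)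
open import Relation.Unary using (Pred; _∈_; _⊆_; _≐_; _∩_; _∪_; ⋃; Empty)
open import Relation.Unary.Polymorphic using (∅; U)

private
  variable
    a ℓ₁ ℓ₂ : Level

------------------------------------------------------------------------
-- Real numbers as two-sided Dedekind cuts of ℚ

record ℝ : Set₁ where
  field
    lower           : Pred ℚ 0ℓ
    upper           : Pred ℚ 0ℓ
    lower-inhabited : ∃ λ q → q ∈ lower
    upper-inhabited : ∃ λ q → q ∈ upper
    lower-rounded   : ∀ q → q ∈ lower ⇔ (∃ λ r → q ℚ.< r × r ∈ lower)
    upper-rounded   : ∀ r → r ∈ upper ⇔ (∃ λ q → q ℚ.< r × q ∈ upper)
    disjoint        : Empty (lower ∩ upper)
    located         : ∀ {q r} → q ℚ.< r → q ∈ lower ⊎ r ∈ upper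

open ℝ

infix 4 _≤ᴿ_

-- Comparing lower halves suffices: either half of a cut determines the other.
_≤ᴿ_ : Rel ℝ 0ℓ
x ≤ᴿ y = lower x ⊆ lower y

fromℚ : ℚ → ℝ
fromℚ p = record
  { lower           = ℚ._< p
  ; upper           = p ℚ.<_
  ; lower-inhabited = p ℚ.- 1ℚ , p-1<p
  ; upper-inhabited = p ℚ.+ 1ℚ , p<p+1
  ; lower-rounded   = λ q → mk⇔ ℚ.<-dense (λ (_ , q<r , r<p) → ℚ.<-trans q<r r<p)
  ; upper-rounded   = λ r → mk⇔ (λ p<r → let (q , p<q , q<r) = ℚ.<-dense p<r in q , q<r , p<q)
                                (λ (_ , q<r , p<q) → ℚ.<-trans p<q q<r)
  ; disjoint        = λ _ (q<p , p<q) → ℚ.<-asym q<p p<q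
  ; located         = loc
  }
  where
  p-1<p : p ℚ.- 1ℚ ℚ.< p
  p-1<p = ℚ.<-≤-trans (ℚ.+-monoʳ-< p (ℚ.negative⁻¹ (ℚ.- 1ℚ))) (ℚ.≤-reflexive (ℚ.+-identityʳ p))

  p<p+1 : p ℚ.< p ℚ.+ 1ℚ
  p<p+1 = ℚ.≤-<-trans (ℚ.≤-reflexive (sym (ℚ.+-identityʳ p)))
                      (ℚ.+-monoʳ-< p (ℚ.positive⁻¹ 1ℚ))

  loc : ∀ {q r} → q ℚ.< r → q ℚ.< p ⊎ p ℚ.< r
  loc {q} q<r with ℚ.<-cmp q p
  ... | tri< q<p _ _  = inj₁ q<p
  ... | tri≈ _ refl _ = inj₂ q<r
  ... | tri> _ _ p<q  = inj₂ (ℚ.<-trans p<q q<r)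

minᴿ : Op₂ ℝ
minᴿ x y = record
  { lower           = lower x ∩ lower y
  ; upper           = upper x ∪ upper y
  ; lower-inhabited = inhabited
  ; upper-inhabited = let (r , r∈) = upper-inhabited x in r , inj₁ r∈
  ; lower-rounded   = λ q → mk⇔ (λ (q∈x , q∈y) → shrink q∈x q∈y)
      (λ (r , q<r , r∈x , r∈y) → Equivalence.from (lower-rounded x q) (r , q<r , r∈x)
                               , Equivalence.from (lower-rounded y q) (r , q<r , r∈y))
  ; upper-rounded   = λ r → mk⇔
      (λ { (inj₁ r∈) → let (q , q<r , q∈) = Equivalence.to (upper-rounded x r) r∈ in q , q<r , inj₁ q∈
         ; (inj₂ r∈) → let (q , q<r , q∈) = Equivalence.to (upper-rounded y r) r∈ in q , q<r , inj₂ q∈ })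
      (λ { (q , q<r , inj₁ q∈) → inj₁ (Equivalence.from (upper-rounded x r) (q , q<r , q∈))
         ; (q , q<r , inj₂ q∈) → inj₂ (Equivalence.from (upper-rounded y r) (q , q<r , q∈)) })
  ; disjoint        = λ { q ((q∈x , _) , inj₁ q∈) → disjoint x q (q∈x , q∈)
                        ; q ((_ , q∈y) , inj₂ q∈) → disjoint y q (q∈y , q∈) }
  ; located         = loc
  }
  where
  down : ∀ z {q r} → q ℚ.< r → r ∈ lower z → q ∈ lower z
  down z q<r r∈ = Equivalence.from (lower-rounded z _) (_ , q<r , r∈)

  inhabited : ∃ λ q → q ∈ lower x ∩ lower y
  inhabited with lower-inhabited x | lower-inhabited y
  ... | q , q∈x | r , r∈y with ℚ.<-cmp q r
  ... | tri< q<r _ _  = q , q∈x , down y q<r r∈y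
  ... | tri≈ _ refl _ = q , q∈x , r∈y
  ... | tri> _ _ r<q  = r , down x r<q q∈x , r∈y

  shrink : ∀ {q} → q ∈ lower x → q ∈ lower y → ∃ λ r → q ℚ.< r × r ∈ lower x ∩ lower y
  shrink {q} q∈x q∈y
    with Equivalence.to (lower-rounded x q) q∈x | Equivalence.to (lower-rounded y q) q∈y
  ... | r , q<r , r∈x | s , q<s , s∈y with ℚ.<-cmp r s
  ... | tri< r<s _ _  = r , q<r , r∈x , down y r<s s∈y
  ... | tri≈ _ refl _ = r , q<r , r∈x , s∈y
  ... | tri> _ _ s<r  = s , q<s , down x s<r r∈x , s∈y

  loc : ∀ {q r} → q ℚ.< r → q ∈ lower x ∩ lower y ⊎ r ∈ upper x ∪ upper y
  loc q<r with located x q<r | located y q<r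
  ... | inj₂ r∈x | _        = inj₂ (inj₁ r∈x)
  ... | inj₁ _   | inj₂ r∈y = inj₂ (inj₂ r∈y)
  ... | inj₁ q∈x | inj₁ q∈y = inj₁ (q∈x , q∈y)

maxᴿ : Op₂ ℝ
maxᴿ x y = record
  { lower           = lower x ∪ lower y
  ; upper           = upper x ∩ upper y
  ; lower-inhabited = let (q , q∈) = lower-inhabited x in q , inj₁ q∈
  ; upper-inhabited = inhabited
  ; lower-rounded   = λ q → mk⇔
      (λ { (inj₁ q∈) → let (r , q<r , r∈) = Equivalence.to (lower-rounded x q) q∈ in r , q<r , inj₁ r∈
         ; (inj₂ q∈) → let (r , q<r , r∈) = Equivalence.to (lower-rounded y q) q∈ in r , q<r , inj₂ r∈ })
      (λ { (r , q<r , inj₁ r∈) → inj₁ (Equivalence.from (lower-rounded x q) (r , q<r , r∈))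
         ; (r , q<r , inj₂ r∈) → inj₂ (Equivalence.from (lower-rounded y q) (r , q<r , r∈)) })
  ; upper-rounded   = λ r → mk⇔ (λ (r∈x , r∈y) → shrink r∈x r∈y)
      (λ (q , q<r , q∈x , q∈y) → Equivalence.from (upper-rounded x r) (q , q<r , q∈x)
                               , Equivalence.from (upper-rounded y r) (q , q<r , q∈y))
  ; disjoint        = λ { q (inj₁ q∈ , q∈x , _) → disjoint x q (q∈ , q∈x)
                        ; q (inj₂ q∈ , _ , q∈y) → disjoint y q (q∈ , q∈y) }
  ; located         = loc
  }
  where
  up : ∀ z {q r} → q ℚ.< r → q ∈ upper z → r ∈ upper z
  up z q<r q∈ = Equivalence.from (upper-rounded z _) (_ , q<r , q∈)

  inhabited : ∃ λ q → q ∈ upper x ∩ upper y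
  inhabited with upper-inhabited x | upper-inhabited y
  ... | q , q∈x | r , r∈y with ℚ.<-cmp q r
  ... | tri< q<r _ _  = r , up x q<r q∈x , r∈y
  ... | tri≈ _ refl _ = q , q∈x , r∈y
  ... | tri> _ _ r<q  = q , q∈x , up y r<q r∈y

  shrink : ∀ {r} → r ∈ upper x → r ∈ upper y → ∃ λ q → q ℚ.< r × q ∈ upper x ∩ upper y
  shrink {r} r∈x r∈y
    with Equivalence.to (upper-rounded x r) r∈x | Equivalence.to (upper-rounded y r) r∈y
  ... | p , p<r , p∈x | q , q<r , q∈y with ℚ.<-cmp p q
  ... | tri< p<q _ _  = q , q<r , up x p<q p∈x , q∈y
  ... | tri≈ _ refl _ = q , q<r , p∈x , q∈y
  ... | tri> _ _ q<p  = p , p<r , p∈x , up y q<p q∈y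

  loc : ∀ {q r} → q ℚ.< r → q ∈ lower x ∪ lower y ⊎ r ∈ upper x ∩ upper y
  loc q<r with located x q<r | located y q<r
  ... | inj₁ q∈x | _        = inj₁ (inj₁ q∈x)
  ... | inj₂ _   | inj₁ q∈y = inj₁ (inj₂ q∈y)
  ... | inj₂ r∈x | inj₂ r∈y = inj₂ (r∈x , r∈y)

------------------------------------------------------------------------
-- The real unit interval

record 𝕀 : Set₁ where
  constructor ⟨_,_,_⟩
  field
    value : ℝ
    0≤    : fromℚ 0ℚ ≤ᴿ value
    ≤1    : value ≤ᴿ fromℚ 1ℚ

open 𝕀

infix 4 _≤ᴵ_ _≈ᴵ_

_≤ᴵ_ : Rel 𝕀 0ℓ
x ≤ᴵ y = value x ≤ᴿ value y

-- Equality of reals: a cut is a pair of predicates, so `_≡_` is too fine.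
_≈ᴵ_ : Rel 𝕀 0ℓ
x ≈ᴵ y = x ≤ᴵ y × y ≤ᴵ x

0≤ᴿ1 : fromℚ 0ℚ ≤ᴿ fromℚ 1ℚ
0≤ᴿ1 q<0 = ℚ.<-trans q<0 (ℚ.positive⁻¹ 1ℚ)

0𝕀 1𝕀 : 𝕀
0𝕀 = ⟨ fromℚ 0ℚ , (λ q<0 → q<0) , 0≤ᴿ1 ⟩
1𝕀 = ⟨ fromℚ 1ℚ , 0≤ᴿ1 , (λ q<1 → q<1) ⟩

min max : Op₂ 𝕀
min ⟨ x , 0≤x , x≤1 ⟩ ⟨ y , 0≤y , y≤1 ⟩ =
  ⟨ minᴿ x y , (λ q<0 → 0≤x q<0 , 0≤y q<0) , x≤1 ∘ proj₁ ⟩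
max ⟨ x , 0≤x , x≤1 ⟩ ⟨ y , 0≤y , y≤1 ⟩ =
  ⟨ maxᴿ x y , inj₁ ∘ 0≤x , Sum.[ x≤1 , y≤1 ] ⟩

------------------------------------------------------------------------
-- BL-algebras

record IsBLAlgebra {A : Set a} (_≈_ : Rel A ℓ₁) (_≤_ : Rel A ℓ₂)
                   (_∧_ _∨_ _*_ _↣_ : Op₂ A) (𝟘 𝟙 : A) : Set (a ⊔ ℓ₁ ⊔ ℓ₂) where
  field
    isBoundedLattice    : IsBoundedLattice _≈_ _≤_ _∨_ _∧_ 𝟙 𝟘
    isCommutativeMonoid : IsCommutativeMonoid _≈_ _*_ 𝟙
    ↣-cong              : Congruent₂ _≈_ _↣_
    residuation         : ∀ x y z → z ≤ (x ↣ y) ⇔ (z * x) ≤ y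
    divisibility        : ∀ x y → (x ∧ y) ≈ (x * (x ↣ y))
    prelinearity        : ∀ x y → ((x ↣ y) ∨ (y ↣ x)) ≈ 𝟙

record BLAlgebra a ℓ₁ ℓ₂ : Set (lsuc (a ⊔ ℓ₁ ⊔ ℓ₂)) where
  field
    Carrier         : Set a
    _≈_             : Rel Carrier ℓ₁
    _≤_             : Rel Carrier ℓ₂
    _∧_ _∨_ _*_ _↣_ : Op₂ Carrier
    𝟘 𝟙             : Carrier
    isBLAlgebra     : IsBLAlgebra _≈_ _≤_ _∧_ _∨_ _*_ _↣_ 𝟘 𝟙

[0,1]⟨_⟩ : {_*_ _↣_ : Op₂ 𝕀} → IsBLAlgebra _≈ᴵ_ _≤ᴵ_ min max _*_ _↣_ 0𝕀 1𝕀 → BLAlgebra _ _ _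
[0,1]⟨ isBL ⟩ = record { isBLAlgebra = isBL }

------------------------------------------------------------------------
-- The *-open sets of a BL-algebra

module StarOpen {a ℓ₁ ℓ₂} (𝓛 : BLAlgebra a ℓ₁ ℓ₂) where
  open BLAlgebra 𝓛
  open ToStrict _≈_ _≤_ using (_<_)

  _≪𝟙 : Pred Carrier (a ⊔ ℓ₁)
  x ≪𝟙 = ∀ y → (x ∨ y) ≈ 𝟙 → y ≈ 𝟙

  _↔_ : Op₂ Carrier
  x ↔ y = (x ↣ y) * (y ↣ x)

  Ball : Carrier → Carrier → Pred Carrier (ℓ₁ ⊔ ℓ₂)
  Ball r x = λ y → r < (x ↔ y)

  T* : ∀ ℓ → Pred (Pred Carrier ℓ) (a ⊔ ℓ₁ ⊔ ℓ₂ ⊔ ℓ)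
  T* ℓ G = ∀ x → x ∈ G → ∃ λ r → r ≪𝟙 × Ball r x ⊆ G

------------------------------------------------------------------------
-- Topologies

-- Points are considered up to `_≈_`, so open sets have to respect it.
-- The union of a family at a large index type is a predicate at a higher level;
-- `⋃-open` therefore speaks about any subset with the same elements as the
-- union. The index level is that of `Pred X ℓ`, so that subcollections of T
-- are among the families.
record IsTopology {X : Set a} {ℓ t : Level} (_≈_ : Rel X ℓ₁) (T : Pred (Pred X ℓ) t)
                  : Set (lsuc (a ⊔ lsuc ℓ) ⊔ ℓ₁ ⊔ t) where
  field
    respects : ∀ {G} → G ∈ T → G Respects _≈_
    ∅-open   : ∅ ∈ T
    U-open   : U ∈ T
    ∩-open   : ∀ {G H} → G ∈ T → H ∈ T → (G ∩ H) ∈ T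
    ⋃-open   : ∀ {I : Set (a ⊔ lsuc ℓ)} (F : I → Pred X ℓ) {G} →
               (∀ i → F i ∈ T) → G ≐ ⋃ I F → G ∈ T

record IsHausdorffTopology {X : Set a} {ℓ t : Level} (_≈_ : Rel X ℓ₁) (T : Pred (Pred X ℓ) t)
                           : Set (lsuc (a ⊔ lsuc ℓ) ⊔ ℓ₁ ⊔ t) where
  field
    isTopology : IsTopology _≈_ T
    hausdorff  : ∀ x y → ¬ (x ≈ y) →
                 ∃ λ G → ∃ λ H → G ∈ T × H ∈ T × x ∈ G × y ∈ H × Empty (G ∩ H)

{-# OPTIONS --safe #-}

-- The biresiduum is transitive, (x ↔ y) * (y ↔ z) ≤ x ↔ z, so it plays the role
-- of a metric. Residuation makes * left-continuous: if s * t ≤ r for all s < 1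
-- then s ≤ t ↣ r for all s < 1, so 1 ≤ t ↣ r and t ≤ r. Hence r < t yields some
-- s < 1 with r < s * t. This makes balls open, and applied twice to x ↔ y < 1 it
-- yields s, t < 1 with x ↔ y < t * s, so that the balls of radius s around x and
-- t around y are disjoint.

module Submission where

open import Defs
open import Algebra.Bundles using (CommutativeMonoid)
open import Algebra.Core using (Op₂)
import Algebra.Properties.CommutativeSemigroup as CommutativeSemigroupProperties
open import Axiom.ExcludedMiddle using (ExcludedMiddle)
open import Data.Empty using (⊥-elim)
open import Data.Product using (∃; _×_; _,_; proj₁; proj₂)
open import Data.Rational as ℚ using (0ℚ; 1ℚ)
import Data.Rational.Properties as ℚ
open import Data.Sum using (inj₁; inj₂)
open import Function using (_∘_; Equivalence)
open import Level using (Level; 0ℓ; _⊔_; Lift; lift)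
import Relation.Binary.Construct.NonStrictToStrict as ToStrict
open import Relation.Binary.Definitions using (Trans; tri<; tri≈; tri>)
open import Relation.Binary.Lattice.Bundles using (BoundedLattice)
import Relation.Binary.Lattice.Properties.BoundedJoinSemilattice as BoundedJoinProperties
import Relation.Binary.Lattice.Properties.JoinSemilattice as JoinProperties
import Relation.Binary.Reasoning.PartialOrder as PosetReasoning
open import Relation.Binary.PropositionalEquality using (refl)
open import Relation.Nullary using (¬_; yes; no; contradiction)
open import Relation.Unary using (_∈_)

-- Residuation, the biresiduum and balls in an arbitrary BL-algebra.

module BLProperties {a ℓ₁ ℓ₂} (𝓛 : BLAlgebra a ℓ₁ ℓ₂) where
  open BLAlgebra 𝓛
    renaming (_≈_ to infix 4 _≈_; _≤_ to infix 4 _≤_; _∨_ to infixr 6 _∨_;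
              _*_ to infixl 7 _*_; _↣_ to infixr 8 _↣_)
  open IsBLAlgebra isBLAlgebra using (isBoundedLattice; isCommutativeMonoid; residuation)
  open StarOpen 𝓛 renaming (_↔_ to infix 8 _↔_)
  open ToStrict _≈_ _≤_ using () renaming (_<_ to infix 4 _<_)

  private
    boundedLattice : BoundedLattice a ℓ₁ ℓ₂
    boundedLattice = record { isBoundedLattice = isBoundedLattice }

    *-commutativeMonoid : CommutativeMonoid a ℓ₁
    *-commutativeMonoid = record { isCommutativeMonoid = isCommutativeMonoid }

  open BoundedLattice boundedLattice
    using (poset; joinSemilattice; boundedJoinSemilattice; antisym; reflexive;
           maximum; x≤x∨y; y≤x∨y; module Eq; ≤-respʳ-≈; ≤-respˡ-≈)
    renaming (refl to ≤-refl; trans to ≤-trans)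
  open CommutativeMonoid *-commutativeMonoid
    using (comm; assoc; identityˡ; ∙-congˡ; commutativeSemigroup)
  open CommutativeSemigroupProperties commutativeSemigroup using (interchange)
  open JoinProperties joinSemilattice using (∨-assoc)
  open BoundedJoinProperties boundedJoinSemilattice
    using () renaming (identityˡ to ∨-identityˡ; identityʳ to ∨-identityʳ)
  open PosetReasoning poset using (begin_; _∎; step-≤; step-≈-⟩)

  <-≤-trans : Trans _<_ _≤_ _<_
  <-≤-trans = ToStrict.<-≤-trans _≈_ _≤_ Eq.sym ≤-trans antisym ≤-respʳ-≈

  ≤-<-trans : Trans _≤_ _<_ _<_
  ≤-<-trans = ToStrict.≤-<-trans _≈_ _≤_ ≤-trans antisym ≤-respˡ-≈

  transpose-* : ∀ {x y z} → z * x ≤ y → z ≤ x ↣ y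
  transpose-* = Equivalence.from (residuation _ _ _)

  transpose-↣ : ∀ {x y z} → z ≤ x ↣ y → z * x ≤ y
  transpose-↣ = Equivalence.to (residuation _ _ _)

  -- Adjointness alone: `y ≤ z ↣ y * z` is the unit of the residuation, and `x ≤ y` can be put in
  -- front of it before transposing back.
  *-monoˡ-≤ : ∀ {x y} z → x ≤ y → x * z ≤ y * z
  *-monoˡ-≤ z x≤y = transpose-↣ (≤-trans x≤y (transpose-* ≤-refl))

  *-mono-≤ : ∀ {x y u v} → x ≤ y → u ≤ v → x * u ≤ y * v
  *-mono-≤ {x} {y} {u} {v} x≤y u≤v = begin
    x * u  ≤⟨ *-monoˡ-≤ u x≤y ⟩
    y * u  ≈⟨ comm y u ⟩
    u * y  ≤⟨ *-monoˡ-≤ y u≤v ⟩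
    v * y  ≈⟨ comm v y ⟩
    y * v  ∎

  x*y≤y : ∀ x y → x * y ≤ y
  x*y≤y x y = ≤-trans (*-monoˡ-≤ y (maximum x)) (reflexive (identityˡ y))

  x*y≤x : ∀ x y → x * y ≤ x
  x*y≤x x y = ≤-trans (reflexive (comm x y)) (x*y≤y y x)

  𝟙≤↣⇒≤ : ∀ {x y} → 𝟙 ≤ x ↣ y → x ≤ y
  𝟙≤↣⇒≤ 𝟙≤x↣y = ≤-trans (reflexive (Eq.sym (identityˡ _))) (transpose-↣ 𝟙≤x↣y)

  ≤⇒𝟙≤↣ : ∀ {x y} → x ≤ y → 𝟙 ≤ x ↣ y
  ≤⇒𝟙≤↣ x≤y = transpose-* (≤-trans (x*y≤y 𝟙 _) x≤y)

  -- Modus ponens twice: multiplying by `x` leads first to `y`, then to `z`.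
  ↣-trans : ∀ x y z → (x ↣ y) * (y ↣ z) ≤ x ↣ z
  ↣-trans x y z = transpose-* (begin
    (x ↣ y) * (y ↣ z) * x    ≤⟨ *-monoˡ-≤ x (reflexive (comm _ _)) ⟩
    (y ↣ z) * (x ↣ y) * x    ≈⟨ assoc _ _ _ ⟩
    (y ↣ z) * ((x ↣ y) * x)  ≤⟨ *-mono-≤ ≤-refl (transpose-↣ ≤-refl) ⟩
    (y ↣ z) * y              ≤⟨ transpose-↣ ≤-refl ⟩
    z                        ∎)

  ↔-trans : ∀ x y z → (x ↔ y) * (y ↔ z) ≤ x ↔ z
  ↔-trans x y z = begin
    (x ↔ y) * (y ↔ z)                              ≈⟨ interchange _ _ _ _ ⟩
    (x ↣ y) * (y ↣ z) * ((y ↣ x) * (z ↣ y))        ≈⟨ ∙-congˡ (comm _ _) ⟩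
    (x ↣ y) * (y ↣ z) * ((z ↣ y) * (y ↣ x))        ≤⟨ *-mono-≤ (↣-trans x y z) (↣-trans z y x) ⟩
    x ↔ z                                          ∎

  ↔-comm : ∀ x y → x ↔ y ≈ y ↔ x
  ↔-comm x y = comm (x ↣ y) (y ↣ x)

  ≈⇒𝟙≤↔ : ∀ {x y} → x ≈ y → 𝟙 ≤ x ↔ y
  ≈⇒𝟙≤↔ x≈y = ≤-trans (reflexive (Eq.sym (identityˡ 𝟙)))
    (*-mono-≤ (≤⇒𝟙≤↣ (reflexive x≈y)) (≤⇒𝟙≤↣ (reflexive (Eq.sym x≈y))))

  ↔≈𝟙⇒≈ : ∀ {x y} → x ↔ y ≈ 𝟙 → x ≈ y
  ↔≈𝟙⇒≈ x↔y≈𝟙 = antisym (𝟙≤↣⇒≤ (≤-trans 𝟙≤x↔y (x*y≤x _ _)))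
                        (𝟙≤↣⇒≤ (≤-trans 𝟙≤x↔y (x*y≤y _ _)))
    where 𝟙≤x↔y = reflexive (Eq.sym x↔y≈𝟙)

  𝟘≪𝟙 : 𝟘 ≪𝟙
  𝟘≪𝟙 y = Eq.trans (Eq.sym (∨-identityˡ y))

  ∨-≪𝟙 : ∀ {r s} → r ≪𝟙 → s ≪𝟙 → (r ∨ s) ≪𝟙
  ∨-≪𝟙 r≪𝟙 s≪𝟙 y r∨s∨y≈𝟙 = s≪𝟙 y (r≪𝟙 _ (Eq.trans (Eq.sym (∨-assoc _ _ y)) r∨s∨y≈𝟙))

  module _ (𝟘≉𝟙 : ¬ 𝟘 ≈ 𝟙) where

    -- With `r ≈ 𝟙` also `r ∨ 𝟘 ≈ 𝟙`, and `r ≪𝟙` would then collapse `𝟘` and `𝟙`. This is what puts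
    -- the centre into each ball.
    ≪𝟙⇒<𝟙 : ∀ {r} → r ≪𝟙 → r < 𝟙
    ≪𝟙⇒<𝟙 {r} r≪𝟙 = maximum r , λ r≈𝟙 → 𝟘≉𝟙 (r≪𝟙 𝟘 (Eq.trans (∨-identityʳ r) r≈𝟙))

    ≈⇒∈Ball : ∀ {r x y} → r ≪𝟙 → x ≈ y → y ∈ Ball r x
    ≈⇒∈Ball r≪𝟙 x≈y = <-≤-trans (≪𝟙⇒<𝟙 r≪𝟙) (≈⇒𝟙≤↔ x≈y)

    T*-isTopology : ∀ ℓ → IsTopology _≈_ (T* ℓ)
    T*-isTopology ℓ = record
      { respects = λ G-open x≈y x∈G →
          let (r , r≪𝟙 , B⊆G) = G-open _ x∈G in B⊆G (≈⇒∈Ball r≪𝟙 x≈y)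
      ; ∅-open   = λ _ ()
      ; U-open   = λ _ _ → 𝟘 , 𝟘≪𝟙 , _
      ; ∩-open   = λ G-open H-open x (x∈G , x∈H) →
          let (r , r≪𝟙 , B⊆G) = G-open x x∈G
              (s , s≪𝟙 , B⊆H) = H-open x x∈H
          in r ∨ s , ∨-≪𝟙 r≪𝟙 s≪𝟙
             , λ z∈B → B⊆G (≤-<-trans (x≤x∨y r s) z∈B) , B⊆H (≤-<-trans (y≤x∨y r s) z∈B)
      ; ⋃-open   = λ F F-open (G⊆⋃F , ⋃F⊆G) x x∈G →
          let (i , x∈Fi)      = G⊆⋃F x∈G
              (r , r≪𝟙 , B⊆F) = F-open i x x∈Fi
          in r , r≪𝟙 , λ z∈B → ⋃F⊆G (i , B⊆F z∈B)
      }

    module _ (left-continuous : ∀ {r t} → r < t → ∃ λ s → s ≪𝟙 × r < s * t) where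

      -- The radius `s` around `y` is chosen so that `s * (x ↔ y)` still exceeds `r`; transitivity
      -- does the rest. `Lift` only adjusts the universe level.
      Ball-open : ∀ ℓ r x → (Lift ℓ ∘ Ball r x) ∈ T* (ℓ₁ ⊔ ℓ₂ ⊔ ℓ)
      Ball-open ℓ r x y (lift r<x↔y) =
        let (s , s≪𝟙 , r<s*x↔y) = left-continuous r<x↔y
        in s , s≪𝟙 , λ {z} s<y↔z → lift (<-≤-trans r<s*x↔y (begin
             s * (x ↔ y)        ≤⟨ *-monoˡ-≤ _ (proj₁ s<y↔z) ⟩
             (y ↔ z) * (x ↔ y)  ≈⟨ comm _ _ ⟩
             (x ↔ y) * (y ↔ z)  ≤⟨ ↔-trans x y z ⟩
             x ↔ z              ∎))

      T*-isHausdorffTopology : ∀ ℓ → IsHausdorffTopology _≈_ (T* (ℓ₁ ⊔ ℓ₂ ⊔ ℓ))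
      T*-isHausdorffTopology ℓ = record
        { isTopology = T*-isTopology _
        ; hausdorff  = λ x y x≉y →
            -- Distinct points satisfy `x ↔ y < 𝟙`, so the first use takes `𝟙` as upper bound and
            -- the second takes the resulting `s * 𝟙`.
            let (s , s≪𝟙 , e<s*𝟙)   = left-continuous (maximum (x ↔ y) , x≉y ∘ ↔≈𝟙⇒≈)
                (t , t≪𝟙 , e<t*s*𝟙) = left-continuous e<s*𝟙
            in Lift ℓ ∘ Ball s x , Lift ℓ ∘ Ball t y
               , Ball-open ℓ s x , Ball-open ℓ t y
               , lift (≈⇒∈Ball s≪𝟙 Eq.refl) , lift (≈⇒∈Ball t≪𝟙 Eq.refl)
               -- A common point `z` would give `x ↔ y < x ↔ y`, against irreflexivity.
               , λ { z (lift s<x↔z , lift t<y↔z) → proj₂ (<-≤-trans e<t*s*𝟙 (begin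
                     t * (s * 𝟙)        ≤⟨ *-mono-≤ (proj₁ t<y↔z) (≤-trans (x*y≤x s 𝟙) (proj₁ s<x↔z)) ⟩
                     (y ↔ z) * (x ↔ z)  ≈⟨ ∙-congˡ (↔-comm x z) ⟩
                     (y ↔ z) * (z ↔ x)  ≤⟨ ↔-trans y z x ⟩
                     y ↔ x              ≈⟨ ↔-comm y x ⟩
                     x ↔ y              ∎)) Eq.refl }
        }

-- Cuts and rational points of the unit interval.

lower-down : ∀ (x : ℝ) {p q} → p ℚ.< q → q ∈ ℝ.lower x → p ∈ ℝ.lower x
lower-down x p<q q∈x = Equivalence.from (ℝ.lower-rounded x _) (_ , p<q , q∈x)

-- A rational `p` in the lower cut of `y` but not in that of `x` bounds the latter from above, which
-- forces `x ≤ᴿ y`.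
≰ᴿ⇒≥ᴿ : ExcludedMiddle 0ℓ → ∀ x y → ¬ (x ≤ᴿ y) → y ≤ᴿ x
≰ᴿ⇒≥ᴿ em x y x≰y {p} p∈y with em {p ∈ ℝ.lower x}
... | yes p∈x = p∈x
... | no  p∉x = ⊥-elim (x≰y x≤y)
  where
  x≤y : x ≤ᴿ y
  x≤y {q} q∈x with q ℚ.<? p
  ... | yes q<p = lower-down y q<p p∈y
  ... | no  q≮p with ℚ.<-cmp p q
  ...   | tri< p<q _ _  = contradiction (lower-down x p<q q∈x) p∉x
  ...   | tri≈ _ refl _ = p∈y
  ...   | tri> _ _ q<p  = contradiction q<p q≮p

fromℚ-mono-≤ : ∀ {p q} → p ℚ.≤ q → fromℚ p ≤ᴿ fromℚ q
fromℚ-mono-≤ p≤q r<p = ℚ.<-≤-trans r<p p≤q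

fromℚᴵ : ∀ q → 0ℚ ℚ.≤ q → q ℚ.< 1ℚ → 𝕀
fromℚᴵ q 0≤q q<1 = ⟨ fromℚ q , fromℚ-mono-≤ 0≤q , fromℚ-mono-≤ (ℚ.<⇒≤ q<1) ⟩

-- Rational points below 1 are strongly less than 1. The lower cut of a maximum is a union and that
-- of `q` omits `q`, so every rational in `[q, 1)` comes from `y`; smaller ones follow by downward
-- closure.
1≤max-fromℚ⇒1≤ : ∀ {q} (y : 𝕀) 0≤q (q<1 : q ℚ.< 1ℚ) →
                 1𝕀 ≤ᴵ max (fromℚᴵ q 0≤q q<1) y → 1𝕀 ≤ᴵ y
1≤max-fromℚ⇒1≤ {q} y 0≤q q<1 1≤q∨y {p} p<1 with p ℚ.<? q
... | no p≮q with 1≤q∨y p<1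
...   | inj₁ p<q = contradiction p<q p≮q
...   | inj₂ p∈y = p∈y
1≤max-fromℚ⇒1≤ {q} y 0≤q q<1 1≤q∨y {p} p<1 | yes p<q with 1≤q∨y q<1
...   | inj₁ q<q = contradiction q<q (ℚ.<-irrefl refl)
...   | inj₂ q∈y = lower-down (𝕀.value y) p<q q∈y

-- A rational strictly between `p` and 1 serves as bound. Negative `p` are split off because that
-- rational must be nonnegative.
fromℚᴵ-dense : ∀ (x : 𝕀) → (∀ q 0≤q q<1 → fromℚᴵ q 0≤q q<1 ≤ᴵ x) → 1𝕀 ≤ᴵ x
fromℚᴵ-dense x bound {p} p<1 with p ℚ.<? 0ℚ
... | yes p<0 = 𝕀.0≤ x p<0
... | no  p≮0 =
  let (q , p<q , q<1) = ℚ.<-dense p<1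
  in bound q (ℚ.<⇒≤ (ℚ.≤-<-trans (ℚ.≮⇒≥ p≮0) p<q)) q<1 p<q

-- Left-continuity of the operation on the unit interval.

module _ (em : ExcludedMiddle 0ℓ) {_*_ _↣_ : Op₂ 𝕀}
         (isBL : IsBLAlgebra _≈ᴵ_ _≤ᴵ_ min max _*_ _↣_ 0𝕀 1𝕀) where
  open StarOpen [0,1]⟨ isBL ⟩ using (_≪𝟙)
  open BLProperties [0,1]⟨ isBL ⟩ using (transpose-*; 𝟙≤↣⇒≤)
  open ToStrict _≈ᴵ_ _≤ᴵ_ using (_<_)

  *-left-continuous : ∀ {r t} → r < t → ∃ λ s → s ≪𝟙 × r < (s * t)
  *-left-continuous {r} {t} (r≤t , r≉t)
    -- The search runs over rationals, not over `𝕀`: `𝕀` lives in `Set₁`, whereas this proposition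
    -- stays at the level of `ExcludedMiddle 0ℓ`.
    with em {∃ λ q → ∃ λ 0≤q → ∃ λ q<1 → ¬ ((fromℚᴵ q 0≤q q<1 * t) ≤ᴵ r)}
  ... | yes (q , 0≤q , q<1 , s*t≰r) =
    fromℚᴵ q 0≤q q<1
    , (λ y q∨y≈1 → 𝕀.≤1 y , 1≤max-fromℚ⇒1≤ y 0≤q q<1 (proj₂ q∨y≈1))
    , ≰ᴿ⇒≥ᴿ em (𝕀.value (fromℚᴵ q 0≤q q<1 * t)) (𝕀.value r) s*t≰r , λ r≈s*t → s*t≰r (proj₂ r≈s*t)
  -- If every rational `q` fails, residuation puts each of them below `t ↣ r`, hence 1 as well, so
  -- `t ≤ᴵ r`.
  ... | no ∄q = ⊥-elim (r≉t (r≤t , 𝟙≤↣⇒≤ (fromℚᴵ-dense (t ↣ r) bound)))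
    where
    bound : ∀ q 0≤q q<1 → fromℚᴵ q 0≤q q<1 ≤ᴵ (t ↣ r)
    bound q 0≤q q<1 with em {(fromℚᴵ q 0≤q q<1 * t) ≤ᴵ r}
    ... | yes s*t≤r = transpose-* s*t≤r
    ... | no  s*t≰r = contradiction (q , 0≤q , q<1 , s*t≰r) ∄q

theorem4p2 : ExcludedMiddle 0ℓ →
    (_*_ _↣_ : Op₂ 𝕀) (isBL : IsBLAlgebra _≈ᴵ_ _≤ᴵ_ min max _*_ _↣_ 0𝕀 1𝕀) →
    ∀ (ℓ : Level) → IsHausdorffTopology _≈ᴵ_ (StarOpen.T* [0,1]⟨ isBL ⟩ ℓ)
theorem4p2 em _*_ _↣_ isBL =
  BLProperties.T*-isHausdorffTopology [0,1]⟨ isBL ⟩ 0≉1 λ {r} {t} → *-left-continuous em isBL {r} {t}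
  where
  0≉1 : ¬ (0𝕀 ≈ᴵ 1𝕀)
  0≉1 (_ , 1≤0) = ℚ.<-irrefl refl (1≤0 (ℚ.positive⁻¹ 1ℚ))
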